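{- The vector space $\mathcal{MD}^{adm}$ is a subalgebra of $\mathcal{MD}$, i.e. it is closed under multiplication of power series.
   Context: For integers $r_1,\dots,r_l\ge 0$ and $n\ge 1$ let $\sigma_{r_1,\dots,r_l}(n)=\sum v_1^{r_1}\cdots v_l^{r_l}$, summed over positive integers $u_1>\dots>u_l>0$, $v_1,\dots,v_l>0$ with $u_1v_1+\dots+u_lv_l=n$. For integers $s_1,\dots,s_l\ge1$ the bracket is $[s_1,\dots,s_l]=\frac{1}{(s_1-1)!\cdots(s_l-1)!}\sum_{n>0}\sigma_{s_1-1,\dots,s_l-1}(n)q^n\in\mathbb{Q}[[q]]$. $\mathcal{MD}$ is the $\mathbb{Q}$-span of $1$ and all brackets; it is a $\mathbb{Q}$-algebra under multiplication of power series. A bracket $[s_1,\dots,s_l]$ is admissible if $s_1>1$, and $\mathcal{MD}^{adm}$ is the $\mathbb{Q}$-span of $1$ and all admissible brackets. -}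

module Defs where

open import Data.Nat as ℕ using (ℕ; zero; suc; _≤_; _<_; _≤ᵇ_; _^_; _!; _∸_)
open import Data.Nat.Properties using (_!≢0)
open import Data.Integer using (+_)
open import Data.Rational using (ℚ; 0ℚ; 1ℚ; _+_; _*_; _/_)
open import Data.Bool using (if_then_else_; _∧_)
open import Data.List using (List; []; _∷_; map; upTo; foldr)
open import Data.List.Relation.Unary.All using (All)
open import Data.Product using (_×_; _,_; Σ; ∃)
open import Relation.Binary.PropositionalEquality using (_≡_)

Series : Set
Series = ℕ → ℚ

sumℕ : List ℕ → ℕ
sumℕ = foldr ℕ._+_ 0

sumℚ : List ℚ → ℚ
sumℚ = foldr _+_ 0ℚ

-- σAux rs n B = Σ v₁^{r₁}⋯v_l^{r_l} over B > u₁ > ⋯ > u_l > 0, v_i > 0,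
-- with u₁v₁ + ⋯ + u_l v_l = n.
σAux : List ℕ → ℕ → ℕ → ℕ
σAux [] zero B = 1
σAux [] (suc n) B = 0
σAux (r ∷ rs) n B =
  sumℕ (map (λ u → sumℕ (map (λ v →
      if (1 ≤ᵇ u) ∧ ((1 ≤ᵇ v) ∧ (u ℕ.* v ≤ᵇ n))
      then v ^ r ℕ.* σAux rs (n ∸ u ℕ.* v) u
      else 0) (upTo (suc n)))) (upTo B))

-- σ_{r₁,…,r_l}(n)  (the bound u₁ ≤ n is automatic since v₁ ≥ 1)
σ : List ℕ → ℕ → ℕ
σ rs n = σAux rs n (suc n)

invFact : ℕ → ℚ
invFact k = (+ 1) / (k !) where instance _ = k !≢0

bracket : List ℕ → Series
bracket s zero = 0ℚ
bracket s (suc n) =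
  foldr (λ sᵢ acc → invFact (sᵢ ∸ 1) * acc) 1ℚ s
    * ((+ σ (map (λ sᵢ → sᵢ ∸ 1) s) (suc n)) / 1)

oneS : Series
oneS zero = 1ℚ
oneS (suc n) = 0ℚ

_⋆_ : Series → Series → Series
(f ⋆ g) n = sumℚ (map (λ k → f k * g (n ∸ k)) (upTo (suc n)))

data Admissible : List ℕ → Set where
  adm : ∀ {s₁ rest} → 2 ≤ s₁ → All (1 ≤_) rest → Admissible (s₁ ∷ rest)

data AdmGen : Set where
  one : AdmGen
  br  : (s : List ℕ) → Admissible s → AdmGen

genSeries : AdmGen → Series
genSeries one = oneS
genSeries (br s _) = bracket s

InMDadm : Series → Set
InMDadm f = Σ (List (ℚ × AdmGen)) λ terms →
  ∀ n → f n ≡ sumℚ (map (λ { (c , g) → c * genSeries g n }) terms)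

{-# OPTIONS --safe #-}
-- Write p_r = Σ_{v>0} v^r q^v = θ^r Z with θ = q d/dq and Z = q/(1-q). A bracket is, up to a
-- rational factor, the sum over u₁ > ⋯ > u_l > 0 of the products p_{s₁-1}(q^{u₁}) ⋯ p_{s_l-1}(q^{u_l}).
-- Multiplying two such sums and splitting on which leading index is larger, or whether they agree,
-- gives a quasi-shuffle recursion whose diagonal term has leading factor (p_a p_b)(q^u). As
-- θ Z = Z + Z², the span of all p_r is Z ℚ[Z], which is closed under products; the span of the
-- p_r with r ≥ 1 is its image under θ, that is (Z + Z²) ℚ[Z], which is closed as well. The latter
-- says that no leading entry 1 arises in the product of two admissible brackets, and makes any
-- knowledge of the Bernoulli numbers in the structure constants unnecessary.
module Submission where

open import Defs
open import Algebra.Bundles using (CommutativeSemiring)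
open import Algebra.Structures.Biased using (isCommutativeSemiringˡ)
import Algebra.Solver.Ring.NaturalCoefficients.Default as SemiringSolver
open import Data.Bool using (true; false; if_then_else_; _∧_)
import Data.Integer as ℤ
import Data.Integer.Properties as ℤP
open import Data.List using (List; []; _∷_; map; upTo; applyUpTo; foldr; _++_; [_])
open import Data.List.Properties using (map-upTo; map-applyUpTo; map-∘; map-id)
open import Data.List.Relation.Unary.All using (All; []; _∷_)
open import Data.Nat as ℕ using (ℕ; zero; suc; z≤n; s≤s; _≤_; _<_; _≤ᵇ_; _^_; _!; _∸_)
import Data.Nat.Properties as ℕP
open import Data.Product using (Σ; _×_; _,_; proj₁; proj₂)
open import Data.Rational using (ℚ; 0ℚ; 1ℚ; _+_; _*_; -_; _/_; toℚᵘ)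
open import Data.Rational.Properties as ℚP
  using (toℚᵘ-injective; toℚᵘ-fromℚᵘ; toℚᵘ-homo-+; toℚᵘ-homo-*)
open import Data.Rational.Solver using (module +-*-Solver)
import Data.Rational.Unnormalised as ℚᵘ
import Data.Rational.Unnormalised.Properties as ℚᵘP
open import Data.Sum using (inj₁; inj₂)
open import Function using (_∘_; const)
open import Relation.Binary.Bundles using (Setoid)
open import Relation.Binary.PropositionalEquality
  using (_≡_; _≗_; _→-setoid_; refl; sym; trans; cong; cong₂; module ≡-Reasoning)

open ≡-Reasoning
open +-*-Solver using (solve; _:=_; _:+_; _:*_; con)

-- Natural numbers as rationals

ι : ℕ → ℚ
ι n = ℤ.+ n / 1

-- `ι n` is normalised by a gcd that does not reduce for a variable `n`, so the homomorphism laws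
-- are checked on unnormalised rationals, where they are integer identities.
toℚᵘ-ι : ∀ n → toℚᵘ (ι n) ℚᵘ.≃ ℚᵘ.mkℚᵘ (ℤ.+ n) 0
toℚᵘ-ι n = toℚᵘ-fromℚᵘ (ℚᵘ.mkℚᵘ (ℤ.+ n) 0)

ι-homo-+ : ∀ m n → ι (m ℕ.+ n) ≡ ι m + ι n
ι-homo-+ m n = toℚᵘ-injective (ℚᵘP.≃-trans (toℚᵘ-ι (m ℕ.+ n)) (ℚᵘP.≃-trans sums
  (ℚᵘP.≃-sym (ℚᵘP.≃-trans (toℚᵘ-homo-+ (ι m) (ι n)) (ℚᵘP.+-cong (toℚᵘ-ι m) (toℚᵘ-ι n))))))
  where
  sums : ℚᵘ.mkℚᵘ (ℤ.+ (m ℕ.+ n)) 0 ℚᵘ.≃ ℚᵘ.mkℚᵘ (ℤ.+ m) 0 ℚᵘ.+ ℚᵘ.mkℚᵘ (ℤ.+ n) 0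
  sums = ℚᵘ.*≡* (cong (ℤ._* ℤ.1ℤ)
    (sym (cong₂ ℤ._+_ (ℤP.*-identityʳ (ℤ.+ m)) (ℤP.*-identityʳ (ℤ.+ n)))))

ι-homo-* : ∀ m n → ι (m ℕ.* n) ≡ ι m * ι n
ι-homo-* m n = toℚᵘ-injective (ℚᵘP.≃-trans (toℚᵘ-ι (m ℕ.* n)) (ℚᵘP.≃-trans products
  (ℚᵘP.≃-sym (ℚᵘP.≃-trans (toℚᵘ-homo-* (ι m) (ι n)) (ℚᵘP.*-cong (toℚᵘ-ι m) (toℚᵘ-ι n))))))
  where
  products : ℚᵘ.mkℚᵘ (ℤ.+ (m ℕ.* n)) 0 ℚᵘ.≃ ℚᵘ.mkℚᵘ (ℤ.+ m) 0 ℚᵘ.* ℚᵘ.mkℚᵘ (ℤ.+ n) 0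
  products = ℚᵘ.*≡* (cong (ℤ._* ℤ.1ℤ) (ℤP.pos-* m n))

reciprocal : ∀ n .{{_ : ℕ.NonZero n}} → (ℤ.+ 1 / n) * ι n ≡ 1ℚ
reciprocal (suc n) = toℚᵘ-injective (ℚᵘP.≃-trans (toℚᵘ-homo-* (ℤ.+ 1 / suc n) (ι (suc n)))
  (ℚᵘP.≃-trans (ℚᵘP.*-cong (toℚᵘ-fromℚᵘ (ℚᵘ.mkℚᵘ (ℤ.+ 1) n)) (toℚᵘ-ι (suc n)))
    (ℚᵘ.*≡* (cong ℤ.+_ (ℕP.*-assoc 1 (suc n) 1)))))

-- Finite sums

∑ : (ℕ → ℚ) → ℕ → ℚ
∑ h n = sumℚ (applyUpTo h n)

∑-cong : ∀ {g h} → g ≗ h → ∀ n → ∑ g n ≡ ∑ h n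
∑-cong e zero = refl
∑-cong e (suc n) = cong₂ _+_ (e 0) (∑-cong (e ∘ suc) n)

∑-zero : ∀ n → ∑ (const 0ℚ) n ≡ 0ℚ
∑-zero zero = refl
∑-zero (suc n) = trans (ℚP.+-identityˡ _) (∑-zero n)

∑-+ : ∀ g h n → ∑ (λ k → g k + h k) n ≡ ∑ g n + ∑ h n
∑-+ g h zero = refl
∑-+ g h (suc n) = trans (cong (g 0 + h 0 +_) (∑-+ (g ∘ suc) (h ∘ suc) n))
  (solve 4 (λ a b c d → (a :+ b) :+ (c :+ d) := (a :+ c) :+ (b :+ d)) refl
    (g 0) (h 0) (∑ (g ∘ suc) n) (∑ (h ∘ suc) n))

∑-*ˡ : ∀ c h n → ∑ (λ k → c * h k) n ≡ c * ∑ h n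
∑-*ˡ c h zero = sym (ℚP.*-zeroʳ c)
∑-*ˡ c h (suc n) = trans (cong (c * h 0 +_) (∑-*ˡ c (h ∘ suc) n)) (sym (ℚP.*-distribˡ-+ c _ _))

∑-last : ∀ h n → ∑ h (suc n) ≡ ∑ h n + h n
∑-last h zero = ℚP.+-comm (h 0) 0ℚ
∑-last h (suc n) = trans (cong (h 0 +_) (∑-last (h ∘ suc) n)) (sym (ℚP.+-assoc (h 0) _ _))

ι-sum : ∀ h n → ι (sumℕ (map h (upTo n))) ≡ ∑ (ι ∘ h) n
ι-sum h n = trans (cong (ι ∘ sumℕ) (map-upTo h n)) (go h n)
  where
  go : ∀ h n → ι (sumℕ (applyUpTo h n)) ≡ ∑ (ι ∘ h) n
  go h zero = refl
  go h (suc n) = trans (ι-homo-+ (h 0) _) (cong (ι (h 0) +_) (go (h ∘ suc) n))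

-- Linear spans of families of rational-valued functions

infixl 6 _⊕_
infixr 7 _·_

_⊕_ : {J : Set} → (J → ℚ) → (J → ℚ) → J → ℚ
(f ⊕ g) j = f j + g j

_·_ : {J : Set} → ℚ → (J → ℚ) → J → ℚ
(c · f) j = c * f j

record Subspace {J : Set} (P : (J → ℚ) → Set) : Set where
  field
    resp  : ∀ {f g} → f ≗ g → P f → P g
    zeroᵖ : P (const 0ℚ)
    add   : ∀ {f g} → P f → P g → P (f ⊕ g)
    scale : ∀ c {f} → P f → P (c · f)

record Linear {J K : Set} (T : (J → ℚ) → K → ℚ) : Set where
  field
    pcong : ∀ {f g} → f ≗ g → T f ≗ T g
    homo⊕ : ∀ f g → T (f ⊕ g) ≗ T f ⊕ T g
    homo· : ∀ c f → T (c · f) ≗ c · T f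

-- At `G = genSeries` this unfolds to `InMDadm`. The type `J` is left arbitrary because spans of
-- doubly indexed families occur below as well as spans of series.
InSpan : {I J : Set} → (I → J → ℚ) → (J → ℚ) → Set
InSpan {I} G f = Σ (List (ℚ × I)) λ terms →
  ∀ j → f j ≡ sumℚ (map (λ { (c , i) → c * G i j }) terms)

module _ {I J : Set} {G : I → J → ℚ} where

  private
    combination : List (ℚ × I) → J → ℚ
    combination ts j = sumℚ (map (λ { (c , i) → c * G i j }) ts)

    combination-++ : ∀ ts us → combination (ts ++ us) ≗ combination ts ⊕ combination us
    combination-++ [] us j = sym (ℚP.+-identityˡ _)
    combination-++ ((c , i) ∷ ts) us j =
      trans (cong (c * G i j +_) (combination-++ ts us j)) (sym (ℚP.+-assoc (c * G i j) _ _))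

    rescale : ℚ → ℚ × I → ℚ × I
    rescale d (c , i) = d * c , i

    combination-rescale : ∀ d ts → combination (map (rescale d) ts) ≗ d · combination ts
    combination-rescale d [] j = sym (ℚP.*-zeroʳ d)
    combination-rescale d ((c , i) ∷ ts) j =
      trans (cong₂ _+_ (ℚP.*-assoc d c (G i j)) (combination-rescale d ts j))
        (sym (ℚP.*-distribˡ-+ d (c * G i j) _))

  span-subspace : Subspace (InSpan G)
  span-subspace = record
    { resp  = λ { e (ts , p) → ts , λ j → trans (sym (e j)) (p j) }
    ; zeroᵖ = [] , λ _ → refl
    ; add   = λ { (ts , p) (us , q) → ts ++ us ,
                  λ j → trans (cong₂ _+_ (p j) (q j)) (sym (combination-++ ts us j)) }
    ; scale = λ { d (ts , p) → map (rescale d) ts ,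
                  λ j → trans (cong (d *_) (p j)) (sym (combination-rescale d ts j)) }
    }

  generator∈span : ∀ i → InSpan G (G i)
  generator∈span i = [ 1ℚ , i ] , λ j → sym (trans (ℚP.+-identityʳ _) (ℚP.*-identityˡ (G i j)))

  span-least : {P : (J → ℚ) → Set} → Subspace P → (∀ i → P (G i)) → ∀ {f} → InSpan G f → P f
  span-least {P} S gens (ts , p) = resp (sym ∘ p) (go ts)
    where
    open Subspace S
    go : ∀ ts → P (combination ts)
    go [] = zeroᵖ
    go ((c , i) ∷ ts) = add (scale c (gens i)) (go ts)

module _ {I J : Set} {G : I → J → ℚ} where
  open Subspace (span-subspace {G = G}) public
    using () renaming (resp to span-resp; add to span-add; scale to span-scale)

preimage : {J K : Set} {T : (J → ℚ) → K → ℚ} {P : (K → ℚ) → Set} →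
  Linear T → Subspace P → Subspace (P ∘ T)
preimage {T = T} L S = record
  { resp  = resp ∘ pcong
  -- By homogeneity T 0 = T (0 · 0) = 0 · T 0 = 0.
  ; zeroᵖ = resp (λ k → trans (sym (ℚP.*-zeroˡ (T (const 0ℚ) k)))
      (trans (sym (homo· 0ℚ (const 0ℚ) k)) (pcong (λ _ → ℚP.*-zeroˡ 0ℚ) k))) zeroᵖ
  ; add   = λ p q → resp (sym ∘ homo⊕ _ _) (add p q)
  ; scale = λ c p → resp (sym ∘ homo· c _) (scale c p)
  }
  where
  open Linear L
  open Subspace S

span-map : {I I′ J K : Set} {G : I → J → ℚ} {H : I′ → K → ℚ} {T : (J → ℚ) → K → ℚ} →
  Linear T → (∀ i → InSpan H (T (G i))) → ∀ {f} → InSpan G f → InSpan H (T f)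
span-map L = span-least (preimage L span-subspace)

-- The semiring of power series

⋆-zero : ∀ f g → (f ⋆ g) 0 ≡ f 0 * g 0
⋆-zero f g = ℚP.+-identityʳ (f 0 * g 0)

-- Writing f = f 0 + q (f ∘ suc) turns the laws of `⋆` into inductions on the coefficient index,
-- with the series left general.
⋆-suc : ∀ f g n → (f ⋆ g) (suc n) ≡ f 0 * g (suc n) + ((f ∘ suc) ⋆ g) n
⋆-suc f g n = cong (λ l → f 0 * g (suc n) + sumℚ l)
  (trans (map-applyUpTo suc (λ k → f k * g (suc n ∸ k)) (suc n))
    (sym (map-upTo (λ k → f (suc k) * g (n ∸ k)) (suc n))))

-- This locality of the Cauchy product is what later allows truncated sums to be compared with their
-- limits.
⋆-cong-≤ : ∀ {f f′ g g′} n → (∀ k → k ≤ n → f k ≡ f′ k) → (∀ k → k ≤ n → g k ≡ g′ k) →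
  (f ⋆ g) n ≡ (f′ ⋆ g′) n
⋆-cong-≤ zero p q = cong (_+ 0ℚ) (cong₂ _*_ (p 0 z≤n) (q 0 z≤n))
⋆-cong-≤ {f} {f′} {g} {g′} (suc n) p q = trans (⋆-suc f g n) (trans
  (cong₂ _+_ (cong₂ _*_ (p 0 z≤n) (q (suc n) ℕP.≤-refl))
    (⋆-cong-≤ n (λ k k≤n → p (suc k) (s≤s k≤n)) (λ k k≤n → q k (ℕP.m≤n⇒m≤1+n k≤n))))
  (sym (⋆-suc f′ g′ n)))

⋆-cong : ∀ {f f′ g g′} → f ≗ f′ → g ≗ g′ → f ⋆ g ≗ f′ ⋆ g′
⋆-cong p q n = ⋆-cong-≤ n (λ k _ → p k) (λ k _ → q k)

⋆-congˡ : ∀ f {g g′} → g ≗ g′ → f ⋆ g ≗ f ⋆ g′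
⋆-congˡ f = ⋆-cong {f = f} (λ _ → refl)

⋆-congʳ : ∀ {f f′} g → f ≗ f′ → f ⋆ g ≗ f′ ⋆ g
⋆-congʳ g p = ⋆-cong {g = g} p (λ _ → refl)

⋆-distribʳ : ∀ g f f′ → (f ⊕ f′) ⋆ g ≗ (f ⋆ g) ⊕ (f′ ⋆ g)
⋆-distribʳ g f f′ zero =
  solve 3 (λ a b c → (a :+ b) :* c :+ con 0ℚ := (a :* c :+ con 0ℚ) :+ (b :* c :+ con 0ℚ)) refl
    (f 0) (f′ 0) (g 0)
⋆-distribʳ g f f′ (suc n) = begin
  ((f ⊕ f′) ⋆ g) (suc n)
    ≡⟨ ⋆-suc (f ⊕ f′) g n ⟩
  (f 0 + f′ 0) * g (suc n) + (((f ∘ suc) ⊕ (f′ ∘ suc)) ⋆ g) n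
    ≡⟨ cong ((f 0 + f′ 0) * g (suc n) +_) (⋆-distribʳ g (f ∘ suc) (f′ ∘ suc) n) ⟩
  (f 0 + f′ 0) * g (suc n) + (((f ∘ suc) ⋆ g) n + ((f′ ∘ suc) ⋆ g) n)
    ≡⟨ solve 5 (λ a b c x y → (a :+ b) :* c :+ (x :+ y) := (a :* c :+ x) :+ (b :* c :+ y)) refl
         (f 0) (f′ 0) (g (suc n)) (((f ∘ suc) ⋆ g) n) (((f′ ∘ suc) ⋆ g) n) ⟩
  (f 0 * g (suc n) + ((f ∘ suc) ⋆ g) n) + (f′ 0 * g (suc n) + ((f′ ∘ suc) ⋆ g) n)
    ≡⟨ sym (cong₂ _+_ (⋆-suc f g n) (⋆-suc f′ g n)) ⟩
  (f ⋆ g) (suc n) + (f′ ⋆ g) (suc n) ∎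

⋆-scaleˡ : ∀ c f g → (c · f) ⋆ g ≗ c · (f ⋆ g)
⋆-scaleˡ c f g zero =
  solve 3 (λ c a b → (c :* a) :* b :+ con 0ℚ := c :* (a :* b :+ con 0ℚ)) refl c (f 0) (g 0)
⋆-scaleˡ c f g (suc n) = begin
  ((c · f) ⋆ g) (suc n)
    ≡⟨ ⋆-suc (c · f) g n ⟩
  (c * f 0) * g (suc n) + ((c · (f ∘ suc)) ⋆ g) n
    ≡⟨ cong ((c * f 0) * g (suc n) +_) (⋆-scaleˡ c (f ∘ suc) g n) ⟩
  (c * f 0) * g (suc n) + c * ((f ∘ suc) ⋆ g) n
    ≡⟨ solve 4 (λ c a b x → (c :* a) :* b :+ c :* x := c :* (a :* b :+ x)) refl
         c (f 0) (g (suc n)) (((f ∘ suc) ⋆ g) n) ⟩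
  c * (f 0 * g (suc n) + ((f ∘ suc) ⋆ g) n)
    ≡⟨ cong (c *_) (sym (⋆-suc f g n)) ⟩
  c * (f ⋆ g) (suc n) ∎

-- Peeling the right factor instead of the left is what commutativity needs: the two expansions then
-- match term by term.
⋆-sucʳ : ∀ f g n → (f ⋆ g) (suc n) ≡ f (suc n) * g 0 + (f ⋆ (g ∘ suc)) n
⋆-sucʳ f g zero = trans (⋆-suc f g 0)
  (solve 2 (λ x y → x :+ (y :+ con 0ℚ) := y :+ (x :+ con 0ℚ)) refl (f 0 * g 1) (f 1 * g 0))
⋆-sucʳ f g (suc n) = begin
  (f ⋆ g) (suc (suc n))
    ≡⟨ ⋆-suc f g (suc n) ⟩
  f 0 * g (2 ℕ.+ n) + ((f ∘ suc) ⋆ g) (suc n)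
    ≡⟨ cong (f 0 * g (2 ℕ.+ n) +_) (⋆-sucʳ (f ∘ suc) g n) ⟩
  f 0 * g (2 ℕ.+ n) + (f (2 ℕ.+ n) * g 0 + ((f ∘ suc) ⋆ (g ∘ suc)) n)
    ≡⟨ solve 3 (λ x y z → x :+ (y :+ z) := y :+ (x :+ z)) refl
         (f 0 * g (2 ℕ.+ n)) (f (2 ℕ.+ n) * g 0) (((f ∘ suc) ⋆ (g ∘ suc)) n) ⟩
  f (2 ℕ.+ n) * g 0 + (f 0 * g (2 ℕ.+ n) + ((f ∘ suc) ⋆ (g ∘ suc)) n)
    ≡⟨ cong (f (2 ℕ.+ n) * g 0 +_) (sym (⋆-suc f (g ∘ suc) n)) ⟩
  f (2 ℕ.+ n) * g 0 + (f ⋆ (g ∘ suc)) (suc n) ∎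

⋆-comm : ∀ f g → f ⋆ g ≗ g ⋆ f
⋆-comm f g zero = cong (_+ 0ℚ) (ℚP.*-comm (f 0) (g 0))
⋆-comm f g (suc n) = begin
  (f ⋆ g) (suc n)
    ≡⟨ ⋆-suc f g n ⟩
  f 0 * g (suc n) + ((f ∘ suc) ⋆ g) n
    ≡⟨ cong₂ _+_ (ℚP.*-comm (f 0) (g (suc n))) (⋆-comm (f ∘ suc) g n) ⟩
  g (suc n) * f 0 + (g ⋆ (f ∘ suc)) n
    ≡⟨ sym (⋆-sucʳ g f n) ⟩
  (g ⋆ f) (suc n) ∎

⋆-assoc : ∀ f g h → (f ⋆ g) ⋆ h ≗ f ⋆ (g ⋆ h)
⋆-assoc f g h zero =
  solve 3 (λ a b c → (a :* b :+ con 0ℚ) :* c :+ con 0ℚ := a :* (b :* c :+ con 0ℚ) :+ con 0ℚ) refl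
    (f 0) (g 0) (h 0)
⋆-assoc f g h (suc n) = begin
  ((f ⋆ g) ⋆ h) (suc n)
    ≡⟨ ⋆-suc (f ⋆ g) h n ⟩
  (f ⋆ g) 0 * h (suc n) + (((f ⋆ g) ∘ suc) ⋆ h) n
    ≡⟨ cong₂ _+_ (cong (_* h (suc n)) (⋆-zero f g)) (⋆-congʳ h (⋆-suc f g) n) ⟩
  (f 0 * g 0) * h (suc n) + (((f 0 · (g ∘ suc)) ⊕ ((f ∘ suc) ⋆ g)) ⋆ h) n
    ≡⟨ cong ((f 0 * g 0) * h (suc n) +_) (trans
         (⋆-distribʳ h (f 0 · (g ∘ suc)) ((f ∘ suc) ⋆ g) n)
         (cong₂ _+_ (⋆-scaleˡ (f 0) (g ∘ suc) h n) (⋆-assoc (f ∘ suc) g h n))) ⟩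
  (f 0 * g 0) * h (suc n) + (f 0 * ((g ∘ suc) ⋆ h) n + ((f ∘ suc) ⋆ (g ⋆ h)) n)
    ≡⟨ solve 5 (λ a b c x y → (a :* b) :* c :+ (a :* x :+ y) := a :* (b :* c :+ x) :+ y) refl
         (f 0) (g 0) (h (suc n)) (((g ∘ suc) ⋆ h) n) (((f ∘ suc) ⋆ (g ⋆ h)) n) ⟩
  f 0 * (g 0 * h (suc n) + ((g ∘ suc) ⋆ h) n) + ((f ∘ suc) ⋆ (g ⋆ h)) n
    ≡⟨ cong (λ x → f 0 * x + ((f ∘ suc) ⋆ (g ⋆ h)) n) (sym (⋆-suc g h n)) ⟩
  f 0 * (g ⋆ h) (suc n) + ((f ∘ suc) ⋆ (g ⋆ h)) n
    ≡⟨ sym (⋆-suc f (g ⋆ h) n) ⟩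
  (f ⋆ (g ⋆ h)) (suc n) ∎

⋆-zeroˡ : ∀ g → const 0ℚ ⋆ g ≗ const 0ℚ
⋆-zeroˡ g n = trans (⋆-congʳ {const 0ℚ} {0ℚ · const 0ℚ} g (λ _ → refl) n)
  (trans (⋆-scaleˡ 0ℚ (const 0ℚ) g n) (ℚP.*-zeroˡ ((const 0ℚ ⋆ g) n)))

⋆-identityˡ : ∀ g → oneS ⋆ g ≗ g
⋆-identityˡ g zero = trans (⋆-zero oneS g) (ℚP.*-identityˡ (g 0))
⋆-identityˡ g (suc n) = trans (⋆-suc oneS g n)
  (trans (cong₂ _+_ (ℚP.*-identityˡ (g (suc n))) (⋆-zeroˡ g n)) (ℚP.+-identityʳ (g (suc n))))

⋆-identityʳ : ∀ g → g ⋆ oneS ≗ g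
⋆-identityʳ g n = trans (⋆-comm g oneS n) (⋆-identityˡ g n)

series-semiring : CommutativeSemiring _ _
series-semiring = record
  { Carrier = Series
  ; _≈_ = _≗_
  ; _+_ = _⊕_
  ; _*_ = _⋆_
  ; 0# = const 0ℚ
  ; 1# = oneS
  ; isCommutativeSemiring = isCommutativeSemiringˡ record
    { +-isCommutativeMonoid = record
      { isMonoid = record
        { isSemigroup = record
          { isMagma = record
            { isEquivalence = ≗-isEquivalence
            ; ∙-cong = λ p q n → cong₂ _+_ (p n) (q n) }
          ; assoc = λ f g h n → ℚP.+-assoc (f n) (g n) (h n) }
        ; identity = (λ f n → ℚP.+-identityˡ (f n)) , λ f n → ℚP.+-identityʳ (f n) }
      ; comm = λ f g n → ℚP.+-comm (f n) (g n) }
    ; *-isCommutativeMonoid = record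
      { isMonoid = record
        { isSemigroup = record
          { isMagma = record
            { isEquivalence = ≗-isEquivalence
            ; ∙-cong = ⋆-cong }
          ; assoc = ⋆-assoc }
        ; identity = ⋆-identityˡ , ⋆-identityʳ }
      ; comm = ⋆-comm }
    ; distribʳ = ⋆-distribʳ
    ; zeroˡ = ⋆-zeroˡ }
  }
  where
  ≗-isEquivalence = Setoid.isEquivalence (ℕ →-setoid ℚ)

module S = SemiringSolver series-semiring

⋆-linearˡ : ∀ g → Linear (_⋆ g)
⋆-linearˡ g = record
  { pcong = ⋆-congʳ g
  ; homo⊕ = ⋆-distribʳ g
  ; homo· = λ c f → ⋆-scaleˡ c f g
  }

⋆-linearʳ : ∀ f → Linear (f ⋆_)
⋆-linearʳ f = record
  { pcong = ⋆-congˡ f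
  ; homo⊕ = λ g h → S.solve 3 (λ f g h → f S.:* (g S.:+ h) S.:= f S.:* g S.:+ f S.:* h)
                      (λ _ → refl) f g h
  ; homo· = λ c g n → trans (⋆-comm f (c · g) n)
                        (trans (⋆-scaleˡ c g f n) (cong (c *_) (⋆-comm g f n)))
  }

-- By bilinearity, one factor at a time. It serves for the powers of Z, for the `geomθ k`, and
-- finally for the generators of `InMDadm`.
⋆-span : {I : Set} {G : I → Series} → (∀ i j → InSpan G (G i ⋆ G j)) →
  ∀ {f g} → InSpan G f → InSpan G g → InSpan G (f ⋆ g)
⋆-span {G = G} closed {g = g} f∈ g∈ =
  span-map (⋆-linearˡ g) (λ i → span-map (⋆-linearʳ (G i)) (closed i) g∈) f∈

-- The Euler derivation and the polynomial algebra generated by q / (1 - q)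

θ : Series → Series
θ f n = ι n * f n

θ-linear : Linear θ
θ-linear = record
  { pcong = λ p n → cong (ι n *_) (p n)
  ; homo⊕ = λ f g n → ℚP.*-distribˡ-+ (ι n) (f n) (g n)
  ; homo· = λ c f n → solve 3 (λ i c x → i :* (c :* x) := c :* (i :* x)) refl (ι n) c (f n)
  }

θ-tail : ∀ f → θ f ∘ suc ≗ θ (f ∘ suc) ⊕ (f ∘ suc)
θ-tail f n = trans (cong (_* f (suc n)) (ι-homo-+ 1 n))
  (solve 2 (λ i x → (con 1ℚ :+ i) :* x := i :* x :+ x) refl (ι n) (f (suc n)))

θ-leibniz : ∀ f g → θ (f ⋆ g) ≗ (θ f ⋆ g) ⊕ (f ⋆ θ g)
θ-leibniz f g zero = solve 2 (λ a b → con 0ℚ :* (a :* b :+ con 0ℚ) :=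
  (con 0ℚ :* a :* b :+ con 0ℚ) :+ (a :* (con 0ℚ :* b) :+ con 0ℚ)) refl (f 0) (g 0)
θ-leibniz f g (suc n) = begin
  ι (suc n) * (f ⋆ g) (suc n)
    ≡⟨ cong₂ _*_ (ι-homo-+ 1 n) (⋆-suc f g n) ⟩
  (1ℚ + ι n) * (f 0 * g (suc n) + (f′ ⋆ g) n)
    ≡⟨ solve 4 (λ i a b x → (con 1ℚ :+ i) :* (a :* b :+ x) :=
         (a :* ((con 1ℚ :+ i) :* b) :+ x) :+ i :* x) refl (ι n) (f 0) (g (suc n)) ((f′ ⋆ g) n) ⟩
  (f 0 * ((1ℚ + ι n) * g (suc n)) + (f′ ⋆ g) n) + ι n * (f′ ⋆ g) n
    ≡⟨ cong₂ _+_ (cong (λ i → f 0 * (i * g (suc n)) + (f′ ⋆ g) n) (sym (ι-homo-+ 1 n)))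
         (θ-leibniz f′ g n) ⟩
  (f 0 * θ g (suc n) + (f′ ⋆ g) n) + ((θ f′ ⋆ g) n + (f′ ⋆ θ g) n)
    -- The zero summand created here is `θ f 0 * g (suc n)`, the head of the product `θ f ⋆ g`,
    -- because `ι 0` computes to `0ℚ`.
    ≡⟨ solve 5 (λ a b x y z → (b :+ x) :+ (y :+ z) := (con 0ℚ :* a :+ (y :+ x)) :+ (b :+ z)) refl
         (f 0 * g (suc n)) (f 0 * θ g (suc n)) ((f′ ⋆ g) n) ((θ f′ ⋆ g) n) ((f′ ⋆ θ g) n) ⟩
  (0ℚ * (f 0 * g (suc n)) + ((θ f′ ⋆ g) n + (f′ ⋆ g) n)) + (f 0 * θ g (suc n) + (f′ ⋆ θ g) n)
    ≡⟨ cong₂ _+_ (cong₂ _+_ (sym (ℚP.*-assoc 0ℚ (f 0) (g (suc n))))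
         (trans (sym (⋆-distribʳ g (θ f′) f′ n)) (sym (⋆-congʳ g (θ-tail f) n))))
         (sym (⋆-suc f (θ g) n)) ⟩
  (θ f 0 * g (suc n) + ((θ f ∘ suc) ⋆ g) n) + (f ⋆ θ g) (suc n)
    ≡⟨ cong (_+ (f ⋆ θ g) (suc n)) (sym (⋆-suc (θ f) g n)) ⟩
  (θ f ⋆ g) (suc n) + (f ⋆ θ g) (suc n) ∎
  where f′ = f ∘ suc

geom : Series
geom zero = 0ℚ
geom (suc n) = 1ℚ

-- For n ≥ 1 the coefficient of q^n in Z² is n - 1, since the tail of Z is constantly 1; the
-- identity reads n = 1 + (n - 1).
θ-geom : θ geom ≗ geom ⊕ (geom ⋆ geom)
θ-geom zero = refl
θ-geom (suc n) = begin
  ι (suc n) * 1ℚ                       ≡⟨ ℚP.*-identityʳ (ι (suc n)) ⟩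
  ι (suc n)                            ≡⟨ ι-homo-+ 1 n ⟩
  1ℚ + ι n                             ≡⟨ cong (1ℚ +_) (sym (partial n)) ⟩
  1ℚ + (const 1ℚ ⋆ geom) n             ≡⟨ cong (1ℚ +_) (sym (trans (⋆-suc geom geom n)
                                            (ℚP.+-identityˡ ((const 1ℚ ⋆ geom) n)))) ⟩
  1ℚ + (geom ⋆ geom) (suc n)           ∎
  where
  partial : ∀ n → (const 1ℚ ⋆ geom) n ≡ ι n
  partial zero = refl
  partial (suc n) = trans (⋆-suc (const 1ℚ) geom n)
    (trans (cong (1ℚ +_) (partial n)) (sym (ι-homo-+ 1 n)))

-- geom^ k is the power with exponent k + 1.
geom^ : ℕ → Series
geom^ zero = geom
geom^ (suc k) = geom ⋆ geom^ k

geom^-⋆ : ∀ a b → geom^ a ⋆ geom^ b ≗ geom^ (suc (a ℕ.+ b))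
geom^-⋆ zero b _ = refl
geom^-⋆ (suc a) b n = trans (⋆-assoc geom (geom^ a) (geom^ b) n) (⋆-congˡ geom (geom^-⋆ a b) n)

-- Z^(k+1) + Z^(k+2) for Z = geom, which spans the image of θ on the powers of Z.
geomθ : ℕ → Series
geomθ k = geom^ k ⊕ geom^ (suc k)

-- The power rule: θ Z^(k+1) = (k+1) Z^k θ Z, with Z + Z² in place of θ Z.
θ-geom^ : ∀ k → θ (geom^ k) ≗ ι (suc k) · geomθ k
θ-geom^ zero n = trans (θ-geom n) (sym (ℚP.*-identityˡ (geomθ 0 n)))
θ-geom^ (suc k) n = begin
  θ (geom ⋆ geom^ k) n
    ≡⟨ θ-leibniz geom (geom^ k) n ⟩
  (θ geom ⋆ geom^ k) n + (geom ⋆ θ (geom^ k)) n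
    ≡⟨ cong₂ _+_ (⋆-congʳ (geom^ k) θ-geom n) (⋆-congˡ geom (θ-geom^ k) n) ⟩
  ((geom ⊕ (geom ⋆ geom)) ⋆ geom^ k) n + (geom ⋆ (ι (suc k) · geomθ k)) n
    ≡⟨ cong₂ _+_
         (S.solve 2 (λ z p → (z S.:+ z S.:* z) S.:* p S.:= z S.:* p S.:+ z S.:* (z S.:* p))
           (λ _ → refl) geom (geom^ k) n)
         (trans (Linear.homo· (⋆-linearʳ geom) (ι (suc k)) (geomθ k) n)
           (cong (ι (suc k) *_) (Linear.homo⊕ (⋆-linearʳ geom) (geom^ k) (geom^ (suc k)) n))) ⟩
  geomθ (suc k) n + ι (suc k) * geomθ (suc k) n
    ≡⟨ solve 2 (λ i x → x :+ i :* x := (con 1ℚ :+ i) :* x) refl (ι (suc k)) (geomθ (suc k) n) ⟩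
  (1ℚ + ι (suc k)) * geomθ (suc k) n
    ≡⟨ cong (_* geomθ (suc k) n) (sym (ι-homo-+ 1 (suc k))) ⟩
  ι (2 ℕ.+ k) * geomθ (suc k) n ∎

-- Both factors carry 1 + Z. One copy is kept and the other expanded, so the product is again a sum
-- of multiples of 1 + Z.
geomθ-⋆ : ∀ a b →
  geomθ a ⋆ geomθ b ≗ geomθ (suc (a ℕ.+ b)) ⊕ geomθ (suc (suc a ℕ.+ b))
geomθ-⋆ a b n = trans
  (S.solve 3 (λ z x y → (x S.:+ z S.:* x) S.:* (y S.:+ z S.:* y) S.:=
      (x S.:* y S.:+ z S.:* (x S.:* y)) S.:+ (z S.:* (x S.:* y) S.:+ z S.:* (z S.:* (x S.:* y))))
    (λ _ → refl) geom (geom^ a) (geom^ b) n)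
  (cong₂ _+_ (cong₂ _+_ (xy n) (⋆-congˡ geom xy n))
    (cong₂ _+_ (⋆-congˡ geom xy n) (⋆-congˡ geom (⋆-congˡ geom xy) n)))
  where xy = geom^-⋆ a b

-- Change of generators between the powers of Z and the series p_r

power : ℕ → Series
power zero = geom
power (suc r) = θ (power r)

power⁺ : ℕ → Series
power⁺ r = power (suc r)

geomθ-θ : ∀ k → geomθ k ≗ (ℤ.+ 1 / suc k) · θ (geom^ k)
geomθ-θ k n = sym (begin
  c * θ (geom^ k) n                  ≡⟨ cong (c *_) (θ-geom^ k n) ⟩
  c * (ι (suc k) * geomθ k n)     ≡⟨ sym (ℚP.*-assoc c (ι (suc k)) (geomθ k n)) ⟩
  c * ι (suc k) * geomθ k n       ≡⟨ cong (_* geomθ k n) (reciprocal (suc k)) ⟩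
  1ℚ * geomθ k n                  ≡⟨ ℚP.*-identityˡ (geomθ k n) ⟩
  geomθ k n                       ∎)
  where c = ℤ.+ 1 / suc k

power∈geom^ : ∀ r → InSpan geom^ (power r)
power∈geom^ zero = generator∈span 0
power∈geom^ (suc r) = span-map θ-linear θ-geom^∈ (power∈geom^ r)
  where
  θ-geom^∈ : ∀ k → InSpan geom^ (θ (geom^ k))
  θ-geom^∈ k = span-resp (sym ∘ θ-geom^ k)
    (span-scale (ι (suc k)) (span-add (generator∈span k) (generator∈span (suc k))))

geomθ∈θ : ∀ {I} {G : I → Series} k → InSpan G (θ (geom^ k)) → InSpan G (geomθ k)
geomθ∈θ k p = span-resp (sym ∘ geomθ-θ k) (span-scale (ℤ.+ 1 / suc k) p)

-- Z^(k+2) is `geomθ k` minus Z^(k+1), and `geomθ k` is a rational multiple of θ Z^(k+1). As θ sends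
-- `power r` to `power (suc r)`, the span of all `power r` contains both.
geom^∈power : ∀ k → InSpan power (geom^ k)
geom^∈power zero = generator∈span 0
geom^∈power (suc k) = span-resp
  (λ n → solve 2 (λ x y → x :+ y :+ con (- 1ℚ) :* x := y) refl (geom^ k n) (geom^ (suc k) n))
  (span-add (geomθ∈θ k (span-map θ-linear (generator∈span ∘ suc) (geom^∈power k)))
    (span-scale (- 1ℚ) (geom^∈power k)))

power⁺∈geomθ : ∀ r → InSpan geomθ (power⁺ r)
power⁺∈geomθ r = span-map θ-linear
  (λ k → span-resp (sym ∘ θ-geom^ k) (span-scale (ι (suc k)) (generator∈span k))) (power∈geom^ r)

-- θ is applied to an expansion of `geom^ k` in all `power r`; it raises every index, as
-- `θ (power r)` is `power⁺ r` by definition.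
geomθ∈power⁺ : ∀ k → InSpan power⁺ (geomθ k)
geomθ∈power⁺ k = geomθ∈θ k (span-map θ-linear generator∈span (geom^∈power k))

power-⋆ : ∀ a b → InSpan power (power a ⋆ power b)
power-⋆ a b = span-least span-subspace geom^∈power (⋆-span closed (power∈geom^ a) (power∈geom^ b))
  where
  closed : ∀ i j → InSpan geom^ (geom^ i ⋆ geom^ j)
  closed i j = span-resp (sym ∘ geom^-⋆ i j) (generator∈span (suc (i ℕ.+ j)))

-- The computation is moved to the `geomθ k`, whose products stay among themselves, so `power 0`
-- never appears on the way back.
power⁺-⋆ : ∀ a b → InSpan power⁺ (power⁺ a ⋆ power⁺ b)
power⁺-⋆ a b =
  span-least span-subspace geomθ∈power⁺ (⋆-span closed (power⁺∈geomθ a) (power⁺∈geomθ b))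
  where
  closed : ∀ i j → InSpan geomθ (geomθ i ⋆ geomθ j)
  closed i j = span-resp (sym ∘ geomθ-⋆ i j)
    (span-add (generator∈span (suc (i ℕ.+ j))) (generator∈span (suc (suc i ℕ.+ j))))

-- Also for r = 0, where `0 ^ 0` would give 1: the sum defining p_r runs over v > 0.
power-0 : ∀ r → power r 0 ≡ 0ℚ
power-0 zero = refl
power-0 (suc r) = ℚP.*-zeroˡ (power r 0)

power-suc : ∀ r n → power r (suc n) ≡ ι (suc n ^ r)
power-suc zero n = refl
power-suc (suc r) n = trans (cong (ι (suc n) *_) (power-suc r n)) (sym (ι-homo-* (suc n) (suc n ^ r)))

-- Dilation of power series

-- q^c f(q^(d+1)), computed with a countdown c so that tails are again dilations.
dilate : (d c : ℕ) → Series → Series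
dilate d zero f zero = f 0
dilate d zero f (suc n) = dilate d d (f ∘ suc) n
dilate d (suc c) f zero = 0ℚ
dilate d (suc c) f (suc n) = dilate d c f n

dilate-linear : ∀ d c → Linear (dilate d c)
dilate-linear d c = record { pcong = pc c ; homo⊕ = h⊕ c ; homo· = λ a f → h· c a f }
  where
  pc : ∀ c {f g} → f ≗ g → dilate d c f ≗ dilate d c g
  pc zero e zero = e 0
  pc zero e (suc n) = pc d (e ∘ suc) n
  pc (suc c) e zero = refl
  pc (suc c) e (suc n) = pc c e n
  h⊕ : ∀ c f g → dilate d c (f ⊕ g) ≗ dilate d c f ⊕ dilate d c g
  h⊕ zero f g zero = refl
  h⊕ zero f g (suc n) = h⊕ d (f ∘ suc) (g ∘ suc) n
  h⊕ (suc c) f g zero = refl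
  h⊕ (suc c) f g (suc n) = h⊕ c f g n
  h· : ∀ c a f → dilate d c (a · f) ≗ a · dilate d c f
  h· zero a f zero = refl
  h· zero a f (suc n) = h· d a (f ∘ suc) n
  h· (suc c) a f zero = sym (ℚP.*-zeroʳ a)
  h· (suc c) a f (suc n) = h· c a f n

-- Substituting q^(d+1) for q is multiplicative. The countdown is general on the left only, since
-- peeling the left factor changes its offset and leaves the right factor intact.
dilate-⋆ : ∀ d c f g → dilate d c f ⋆ dilate d 0 g ≗ dilate d c (f ⋆ g)
dilate-⋆ d zero f g zero = refl
dilate-⋆ d zero f g (suc n) = begin
  (dilate d 0 f ⋆ dilate d 0 g) (suc n)
    ≡⟨ ⋆-suc (dilate d 0 f) (dilate d 0 g) n ⟩
  f 0 * dilate d d (g ∘ suc) n + (dilate d d (f ∘ suc) ⋆ dilate d 0 g) n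
    ≡⟨ cong₂ _+_ (sym (homo· (f 0) (g ∘ suc) n)) (dilate-⋆ d d (f ∘ suc) g n) ⟩
  dilate d d (f 0 · (g ∘ suc)) n + dilate d d ((f ∘ suc) ⋆ g) n
    ≡⟨ sym (homo⊕ (f 0 · (g ∘ suc)) ((f ∘ suc) ⋆ g) n) ⟩
  dilate d d ((f 0 · (g ∘ suc)) ⊕ ((f ∘ suc) ⋆ g)) n
    ≡⟨ sym (pcong (⋆-suc f g) n) ⟩
  dilate d d ((f ⋆ g) ∘ suc) n ∎
  where open Linear (dilate-linear d d)
dilate-⋆ d (suc c) f g zero = cong (_+ 0ℚ) (ℚP.*-zeroˡ (dilate d 0 g 0))
dilate-⋆ d (suc c) f g (suc n) = begin
  (dilate d (suc c) f ⋆ dilate d 0 g) (suc n)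
    ≡⟨ ⋆-suc (dilate d (suc c) f) (dilate d 0 g) n ⟩
  0ℚ * dilate d 0 g (suc n) + (dilate d c f ⋆ dilate d 0 g) n
    ≡⟨ cong₂ _+_ (ℚP.*-zeroˡ (dilate d 0 g (suc n))) (dilate-⋆ d c f g n) ⟩
  0ℚ + dilate d c (f ⋆ g) n
    ≡⟨ ℚP.+-identityˡ (dilate d c (f ⋆ g) n) ⟩
  dilate d c (f ⋆ g) n ∎

dilate-< : ∀ d c f {n} → n < c → dilate d c f n ≡ 0ℚ
dilate-< d (suc c) f {zero} _ = refl
dilate-< d (suc c) f {suc n} (s≤s n<c) = dilate-< d c f n<c

dilate-≤ : ∀ d f {n} → f 0 ≡ 0ℚ → n ≤ d → dilate d 0 f n ≡ 0ℚ
dilate-≤ d f {zero} f0 _ = f0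
dilate-≤ d f {suc n} _ n<d = dilate-< d d (f ∘ suc) n<d

-- Multiplication by q^m, with the Boolean test of `σAux` so that one case split on that test
-- settles both sides.
shift : ℕ → Series → Series
shift m f n = if m ≤ᵇ n then f (n ∸ m) else 0ℚ

shift-suc : ∀ m f n → shift (suc m) f (suc n) ≡ shift m f n
shift-suc zero f n = refl
shift-suc (suc m) f n = refl

-- Termwise, q^c f(q^(d+1)) is the sum of f v q^(c+(d+1)v), and terms with v > n do not reach degree
-- n. The bound `N` is free because `n` decreases alone while the countdown runs.
dilate-⋆-∑ : ∀ d c f g {N} n → n < N →
  ∑ (λ v → f v * shift (c ℕ.+ suc d ℕ.* v) g n) N ≡ (dilate d c f ⋆ g) n
dilate-⋆-∑ d zero f g {suc N} zero _ = cong₂ _+_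
  (cong (λ m → f 0 * shift m g 0) (ℕP.*-zeroʳ d))
  (trans (∑-cong (λ v → ℚP.*-zeroʳ (f (suc v))) N) (∑-zero N))
dilate-⋆-∑ d zero f g {suc N} (suc n) (s≤s n<N) = trans
  (cong₂ _+_ (cong (λ m → f 0 * shift m g (suc n)) (ℕP.*-zeroʳ d))
    (trans (∑-cong step N) (dilate-⋆-∑ d d (f ∘ suc) g n n<N)))
  (sym (⋆-suc (dilate d 0 f) g n))
  where
  step : ∀ v → f (suc v) * shift (suc d ℕ.* suc v) g (suc n) ≡
    f (suc v) * shift (d ℕ.+ suc d ℕ.* v) g n
  step v = cong (f (suc v) *_) (trans (cong (λ m → shift m g (suc n)) (ℕP.*-suc (suc d) v))
    (shift-suc (d ℕ.+ suc d ℕ.* v) g n))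
dilate-⋆-∑ d (suc c) f g {N} zero _ =
  trans (trans (∑-cong (λ v → ℚP.*-zeroʳ (f v)) N) (∑-zero N))
    (sym (cong (_+ 0ℚ) (ℚP.*-zeroˡ (g 0))))
dilate-⋆-∑ d (suc c) f g {N} (suc n) n<N = begin
  ∑ (λ v → f v * shift (suc c ℕ.+ suc d ℕ.* v) g (suc n)) N
    ≡⟨ ∑-cong (λ v → cong (f v *_) (shift-suc (c ℕ.+ suc d ℕ.* v) g n)) N ⟩
  ∑ (λ v → f v * shift (c ℕ.+ suc d ℕ.* v) g n) N
    ≡⟨ dilate-⋆-∑ d c f g n (ℕP.<-trans (ℕP.n<1+n n) n<N) ⟩
  (dilate d c f ⋆ g) n
    ≡⟨ sym (ℚP.+-identityˡ ((dilate d c f ⋆ g) n)) ⟩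
  0ℚ + (dilate d c f ⋆ g) n
    ≡⟨ cong (_+ (dilate d c f ⋆ g) n) (sym (ℚP.*-zeroˡ (g (suc n)))) ⟩
  0ℚ * g (suc n) + (dilate d c f ⋆ g) n
    ≡⟨ sym (⋆-suc (dilate d (suc c) f) g n) ⟩
  (dilate d (suc c) f ⋆ g) (suc n) ∎

-- Truncated brackets

-- X (b , n) is the coefficient of q^n in a sum restricted to u₁ ≤ b.
Family : Set
Family = ℕ × ℕ → ℚ

slice : Family → ℕ → Series
slice X b n = X (b , n)

infixl 8 _⊛_

_⊛_ : Family → Family → Family
(X ⊛ Y) (b , n) = (slice X b ⋆ slice Y b) n

-- Σ_{0<u≤b} f(q^u) X_{u-1}, with u = k + 1
prepend : Series → Family → Family
prepend f X (b , n) = ∑ (λ k → (dilate k 0 f ⋆ slice X k) n) b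

truncated : List ℕ → Family
truncated [] (b , n) = oneS n
truncated (r ∷ rs) = prepend (power r) (truncated rs)

prepend-linearˡ : ∀ X → Linear (λ f → prepend f X)
prepend-linearˡ X = record
  { pcong = λ e → λ { (b , n) → ∑-cong (λ k →
      ⋆-congʳ (slice X k) (pcong (dilate-linear k 0) e) n) b }
  ; homo⊕ = λ f g → λ { (b , n) → trans (∑-cong (λ k → trans
      (⋆-congʳ (slice X k) (homo⊕ (dilate-linear k 0) f g) n)
      (⋆-distribʳ (slice X k) (dilate k 0 f) (dilate k 0 g) n)) b) (∑-+ _ _ b) }
  ; homo· = λ c f → λ { (b , n) → trans (∑-cong (λ k → trans
      (⋆-congʳ (slice X k) (homo· (dilate-linear k 0) c f) n)
      (⋆-scaleˡ c (dilate k 0 f) (slice X k) n)) b) (∑-*ˡ c _ b) }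
  }
  where open Linear

prepend-linearʳ : ∀ f → Linear (prepend f)
prepend-linearʳ f = record
  { pcong = λ e → λ { (b , n) → ∑-cong (λ k →
      ⋆-congˡ (dilate k 0 f) (λ m → e (k , m)) n) b }
  ; homo⊕ = λ X Y → λ { (b , n) → trans (∑-cong (λ k →
      homo⊕ (⋆-linearʳ (dilate k 0 f)) (slice X k) (slice Y k) n) b) (∑-+ _ _ b) }
  ; homo· = λ c X → λ { (b , n) → trans (∑-cong (λ k →
      homo· (⋆-linearʳ (dilate k 0 f)) c (slice X k) n) b) (∑-*ˡ c _ b) }
  }
  where open Linear

prepend-⊛ : ∀ f g X Y → prepend f X ⊛ prepend g Y ≗
  prepend f (X ⊛ prepend g Y) ⊕ prepend g (prepend f X ⊛ Y) ⊕ prepend (f ⋆ g) (X ⊛ Y)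
prepend-⊛ f g X Y (zero , n) = ⋆-zeroˡ (const 0ℚ) n
prepend-⊛ f g X Y (suc b , n) = begin
  (slice FX (suc b) ⋆ slice GY (suc b)) n
    ≡⟨ ⋆-cong (λ m → ∑-last (λ k → (dilate k 0 f ⋆ slice X k) m) b)
              (λ m → ∑-last (λ k → (dilate k 0 g ⋆ slice Y k) m) b) n ⟩
  ((P ⊕ (F ⋆ x)) ⋆ (Q ⊕ (G ⋆ y))) n
    -- `F ⋆ x` and `G ⋆ y` are the summands with leading index b + 1. The three new products are
    -- those where this index occurs on the left only, on the right only, or on both sides.
    ≡⟨ S.solve 6 (λ p q f g x y → (p S.:+ f S.:* x) S.:* (q S.:+ g S.:* y) S.:=
         p S.:* q S.:+ (f S.:* (x S.:* q) S.:+ g S.:* (p S.:* y) S.:+ f S.:* g S.:* (x S.:* y)))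
         (λ _ → refl) P Q F G x y n ⟩
  (P ⋆ Q) n + ((F ⋆ (x ⋆ Q)) n + (G ⋆ (P ⋆ y)) n + ((F ⋆ G) ⋆ (x ⋆ y)) n)
    ≡⟨ cong₂ _+_ (prepend-⊛ f g X Y (b , n))
         (cong ((F ⋆ (x ⋆ Q)) n + (G ⋆ (P ⋆ y)) n +_)
           (⋆-congʳ (x ⋆ y) (dilate-⋆ b 0 f g) n)) ⟩
  (A (b , n) + B (b , n) + C (b , n)) +
    ((F ⋆ (x ⋆ Q)) n + (G ⋆ (P ⋆ y)) n + (dilate b 0 (f ⋆ g) ⋆ (x ⋆ y)) n)
    ≡⟨ solve 6 (λ a b c u v w → (a :+ b :+ c) :+ (u :+ v :+ w) := (a :+ u) :+ (b :+ v) :+ (c :+ w))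
         refl (A (b , n)) (B (b , n)) (C (b , n))
         ((F ⋆ (x ⋆ Q)) n) ((G ⋆ (P ⋆ y)) n) ((dilate b 0 (f ⋆ g) ⋆ (x ⋆ y)) n) ⟩
  (A (b , n) + (F ⋆ (x ⋆ Q)) n) + (B (b , n) + (G ⋆ (P ⋆ y)) n) +
    (C (b , n) + (dilate b 0 (f ⋆ g) ⋆ (x ⋆ y)) n)
    ≡⟨ sym (cong₂ _+_ (cong₂ _+_
         (∑-last (λ k → (dilate k 0 f ⋆ slice (X ⊛ GY) k) n) b)
         (∑-last (λ k → (dilate k 0 g ⋆ slice (FX ⊛ Y) k) n) b))
         (∑-last (λ k → (dilate k 0 (f ⋆ g) ⋆ slice (X ⊛ Y) k) n) b)) ⟩
  A (suc b , n) + B (suc b , n) + C (suc b , n) ∎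
  where
  FX = prepend f X
  GY = prepend g Y
  A = prepend f (X ⊛ GY)
  B = prepend g (FX ⊛ Y)
  C = prepend (f ⋆ g) (X ⊛ Y)
  P = slice FX b
  Q = slice GY b
  F = dilate b 0 f
  G = dilate b 0 g
  x = slice X b
  y = slice Y b

-- Entries are the exponents s_i - 1, so a leading `suc r` encodes s₁ = r + 2 and builds
-- admissibility into the index.
truncated-admissible : ℕ × List ℕ → Family
truncated-admissible (r , rs) = truncated (suc r ∷ rs)

prepend∈truncated : ∀ {f X} → InSpan power f → InSpan truncated X → InSpan truncated (prepend f X)
prepend∈truncated {X = X} f∈ X∈ = span-map (prepend-linearˡ X)
  (λ r → span-map (prepend-linearʳ (power r)) (λ rs → generator∈span (r ∷ rs)) X∈) f∈

-- Admissibility concerns the leading factor alone, so the tail may lie in the span of all truncated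
-- brackets.
prepend∈admissible : ∀ {f X} →
  InSpan power⁺ f → InSpan truncated X → InSpan truncated-admissible (prepend f X)
prepend∈admissible {X = X} f∈ X∈ = span-map (prepend-linearˡ X)
  (λ r → span-map (prepend-linearʳ (power⁺ r)) (λ rs → generator∈span (r , rs)) X∈) f∈

-- The span is one of families, so the coefficients are the same for every bound b; `prepend` relies
-- on this, as it combines slices at different bounds. Each recursive call drops a leading entry.
truncated-⊛ : ∀ rs ts → InSpan truncated (truncated rs ⊛ truncated ts)
truncated-⊛ [] ts =
  span-resp (λ { (b , n) → sym (⋆-identityˡ (slice (truncated ts) b) n) }) (generator∈span ts)
truncated-⊛ (r ∷ rs) [] =
  span-resp (λ { (b , n) → sym (⋆-identityʳ (slice (truncated (r ∷ rs)) b) n) })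
    (generator∈span (r ∷ rs))
truncated-⊛ (r ∷ rs) (t ∷ ts) =
  span-resp (sym ∘ prepend-⊛ (power r) (power t) (truncated rs) (truncated ts))
    (span-add (span-add
      (prepend∈truncated (generator∈span r) (truncated-⊛ rs (t ∷ ts)))
      (prepend∈truncated (generator∈span t) (truncated-⊛ (r ∷ rs) ts)))
      (prepend∈truncated (power-⋆ r t) (truncated-⊛ rs ts)))

-- One quasi-shuffle step suffices: all three leading factors lie in the span of `power⁺`, and the
-- tails are covered by `truncated-⊛`.
admissible-⊛ : ∀ x y →
  InSpan truncated-admissible (truncated-admissible x ⊛ truncated-admissible y)
admissible-⊛ (r , rs) (t , ts) =
  span-resp (sym ∘ prepend-⊛ (power⁺ r) (power⁺ t) (truncated rs) (truncated ts))
    (span-add (span-add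
      (prepend∈admissible (generator∈span r) (truncated-⊛ rs (suc t ∷ ts)))
      (prepend∈admissible (generator∈span t) (truncated-⊛ (suc r ∷ rs) ts)))
      (prepend∈admissible (power⁺-⋆ r t) (truncated-⊛ rs ts)))

-- Brackets as diagonals of truncated brackets

Stable : Family → Set
Stable X = ∀ b n → n ≤ b → X (b , n) ≡ X (n , n)

⋆-vanish : ∀ f g n → (∀ k → k ≤ n → f k ≡ 0ℚ) → (f ⋆ g) n ≡ 0ℚ
⋆-vanish f g n p =
  trans (⋆-cong-≤ {f} {const 0ℚ} {g} {g} n p (λ _ _ → refl)) (⋆-zeroˡ g n)

-- Without a constant term, f(q^u) starts in degree u, so indices u > n do not affect the
-- coefficient of q^n.
prepend-stable : ∀ f X → f 0 ≡ 0ℚ → Stable (prepend f X)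
prepend-stable f X f0 b n n≤b with ℕP.m≤n⇒m<n∨m≡n n≤b
... | inj₂ refl = refl
prepend-stable f X f0 (suc b) n _ | inj₁ (s≤s n≤b) = begin
  prepend f X (suc b , n)
    ≡⟨ ∑-last (λ k → (dilate k 0 f ⋆ slice X k) n) b ⟩
  prepend f X (b , n) + (dilate b 0 f ⋆ slice X b) n
    ≡⟨ cong₂ _+_ (prepend-stable f X f0 b n n≤b) (⋆-vanish (dilate b 0 f) (slice X b) n
         (λ k k≤n → dilate-≤ b f f0 (ℕP.≤-trans k≤n n≤b))) ⟩
  prepend f X (n , n) + 0ℚ
    ≡⟨ ℚP.+-identityʳ (prepend f X (n , n)) ⟩
  prepend f X (n , n) ∎

truncated-stable : ∀ rs → Stable (truncated rs)
truncated-stable [] b n _ = refl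
truncated-stable (r ∷ rs) = prepend-stable (power r) (truncated rs) (power-0 r)

diagonal : Family → Series
diagonal X n = X (n , n)

diagonal-linear : Linear diagonal
diagonal-linear = record
  { pcong = λ e n → e (n , n) ; homo⊕ = λ _ _ _ → refl ; homo· = λ _ _ _ → refl }

-- The left side reads the factors at (k , k), the right side at (n , k) with k ≤ n; stability
-- identifies the two.
diagonal-⋆ : ∀ {X Y} → Stable X → Stable Y → diagonal X ⋆ diagonal Y ≗ diagonal (X ⊛ Y)
diagonal-⋆ p q n =
  ⋆-cong-≤ n (λ k k≤n → sym (p n k k≤n)) (λ k k≤n → sym (q n k k≤n))

-- The bound of `σAux` is strict and that of `truncated` is not, hence `suc b`; for `σ` this lands
-- on the diagonal.
ι-σAux : ∀ rs n b → ι (σAux rs n (suc b)) ≡ truncated rs (b , n)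
ι-σAux [] zero b = refl
ι-σAux [] (suc n) b = refl
ι-σAux (r ∷ rs) n b = begin
  ι (sumℕ (map inner (upTo (suc b))))
    ≡⟨ ι-sum inner (suc b) ⟩
  ι (inner 0) + ∑ (ι ∘ inner ∘ suc) b
    -- The summand u = 0 fails the test `1 ≤ᵇ u`; the others are reindexed by u = k + 1.
    ≡⟨ cong₂ _+_ (trans (ι-sum (term 0) (suc n)) (∑-zero (suc n))) (∑-cong inner-suc b) ⟩
  0ℚ + ∑ (λ k → (dilate k 0 (power r) ⋆ slice (truncated rs) k) n) b
    ≡⟨ ℚP.+-identityˡ _ ⟩
  truncated (r ∷ rs) (b , n) ∎
  where
  term : ℕ → ℕ → ℕ
  term u v = if (1 ≤ᵇ u) ∧ ((1 ≤ᵇ v) ∧ (u ℕ.* v ≤ᵇ n))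
    then v ^ r ℕ.* σAux rs (n ∸ u ℕ.* v) u else 0
  inner : ℕ → ℕ
  inner u = sumℕ (map (term u) (upTo (suc n)))
  term-suc : ∀ k v →
    ι (term (suc k) v) ≡ power r v * shift (suc k ℕ.* v) (slice (truncated rs) k) n
  -- For v = 0 the test gives 0 on the left, and the missing constant term of `power r` does so on
  -- the right.
  term-suc k zero = sym (trans (cong (_* y) (power-0 r)) (ℚP.*-zeroˡ y))
    where y = shift (suc k ℕ.* 0) (slice (truncated rs) k) n
  term-suc k (suc v) with suc k ℕ.* suc v ≤ᵇ n
  ... | true = trans (ι-homo-* (suc v ^ r) _)
    (cong₂ _*_ (sym (power-suc r v)) (ι-σAux rs (n ∸ suc k ℕ.* suc v) k))
  ... | false = sym (ℚP.*-zeroʳ (power r (suc v)))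
  inner-suc : ∀ k → ι (inner (suc k)) ≡ (dilate k 0 (power r) ⋆ slice (truncated rs) k) n
  inner-suc k = trans (ι-sum (term (suc k)) (suc n)) (trans (∑-cong (term-suc k) (suc n))
    (dilate-⋆-∑ k 0 (power r) (slice (truncated rs) k) n ℕP.≤-refl))

-- Factorial factors and the return to brackets

normalisation : List ℕ → ℚ
normalisation = foldr (λ sᵢ acc → invFact (sᵢ ∸ 1) * acc) 1ℚ

factorials : List ℕ → ℚ
factorials = foldr (λ r acc → ι (r !) * acc) 1ℚ

normalisation-factorials : ∀ rs → normalisation (map suc rs) * factorials rs ≡ 1ℚ
normalisation-factorials [] = refl
normalisation-factorials (r ∷ rs) = begin
  (invFact r * normalisation (map suc rs)) * (ι (r !) * factorials rs)
    ≡⟨ solve 4 (λ a b c d → (a :* b) :* (c :* d) := (a :* c) :* (b :* d)) refl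
         (invFact r) (normalisation (map suc rs)) (ι (r !)) (factorials rs) ⟩
  (invFact r * ι (r !)) * (normalisation (map suc rs) * factorials rs)
    ≡⟨ cong₂ _*_ (reciprocal (r !) {{r ℕP.!≢0}}) (normalisation-factorials rs) ⟩
  1ℚ * 1ℚ ∎

-- The list is nonempty because `bracket []` is the zero series while `truncated []` is 1. In degree
-- 0 the truncated sum is empty and computes to 0.
bracket-diagonal : ∀ s₁ s → let s′ = s₁ ∷ s in
  bracket s′ ≗ normalisation s′ · diagonal (truncated (map (_∸ 1) s′))
bracket-diagonal s₁ s zero = sym (ℚP.*-zeroʳ (normalisation (s₁ ∷ s)))
bracket-diagonal s₁ s (suc n) =
  cong (normalisation (s₁ ∷ s) *_) (ι-σAux (map (_∸ 1) (s₁ ∷ s)) (suc n) (suc n))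

diagonal-bracket : ∀ r rs → let rs′ = r ∷ rs in
  diagonal (truncated rs′) ≗ factorials rs′ · bracket (map suc rs′)
diagonal-bracket r rs n = sym (begin
  F * bracket (map suc (r ∷ rs)) n
    ≡⟨ cong (F *_) (bracket-diagonal (suc r) (map suc rs) n) ⟩
  F * (N * truncated (r ∷ map (_∸ 1) (map suc rs)) (n , n))
    ≡⟨ cong (λ ts → F * (N * truncated (r ∷ ts) (n , n)))
         (trans (sym (map-∘ rs)) (map-id rs)) ⟩
  F * (N * T)
    ≡⟨ solve 3 (λ f n t → f :* (n :* t) := (n :* f) :* t) refl F N T ⟩
  N * F * T
    ≡⟨ cong (_* T) (normalisation-factorials (r ∷ rs)) ⟩
  1ℚ * T
    ≡⟨ ℚP.*-identityˡ T ⟩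
  T ∎)
  where
  F = factorials (r ∷ rs)
  N = normalisation (map suc (r ∷ rs))
  T = truncated (r ∷ rs) (n , n)

diagonal∈MDadm : ∀ x → InMDadm (diagonal (truncated-admissible x))
diagonal∈MDadm (r , rs) = span-resp (sym ∘ diagonal-bracket (suc r) rs)
  (span-scale (factorials (suc r ∷ rs))
    (generator∈span (br (map suc (suc r ∷ rs)) (adm (s≤s (s≤s z≤n)) (positive rs)))))
  where
  positive : ∀ ts → All (1 ≤_) (map suc ts)
  positive [] = []
  positive (t ∷ ts) = s≤s z≤n ∷ positive ts

bracket∈diagonal : ∀ s → Admissible s → Σ (ℕ × List ℕ) λ x →
  bracket s ≗ normalisation s · diagonal (truncated-admissible x)
bracket∈diagonal (_ ∷ s) (adm (s≤s (s≤s {n = r} z≤n)) _) =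
  (r , map (_∸ 1) s) , bracket-diagonal (2 ℕ.+ r) s

generator-⋆ : ∀ i j → InMDadm (genSeries i ⋆ genSeries j)
generator-⋆ one j = span-resp (sym ∘ ⋆-identityˡ (genSeries j)) (generator∈span j)
generator-⋆ i one = span-resp (sym ∘ ⋆-identityʳ (genSeries i)) (generator∈span i)
generator-⋆ (br s s-adm) (br t t-adm)
  with bracket∈diagonal s s-adm | bracket∈diagonal t t-adm
... | x , s≗ | y , t≗ =
  -- The product is expanded at the level of families, and only then is the diagonal taken and
  -- turned back into admissible brackets.
  span-resp (sym ∘ expand) (span-scale c (span-scale d
    (span-map diagonal-linear diagonal∈MDadm (admissible-⊛ x y))))
  where
  c = normalisation s
  d = normalisation t
  X = truncated-admissible x
  Y = truncated-admissible y
  expand : bracket s ⋆ bracket t ≗ c · d · diagonal (X ⊛ Y)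
  expand n = begin
    (bracket s ⋆ bracket t) n
      ≡⟨ ⋆-cong s≗ t≗ n ⟩
    ((c · diagonal X) ⋆ (d · diagonal Y)) n
      ≡⟨ ⋆-scaleˡ c (diagonal X) (d · diagonal Y) n ⟩
    c * (diagonal X ⋆ (d · diagonal Y)) n
      ≡⟨ cong (c *_) (Linear.homo· (⋆-linearʳ (diagonal X)) d (diagonal Y) n) ⟩
    c * (d * (diagonal X ⋆ diagonal Y) n)
      ≡⟨ cong (λ z → c * (d * z)) (diagonal-⋆ {X} {Y}
           (truncated-stable (suc (proj₁ x) ∷ proj₂ x)) (truncated-stable (suc (proj₁ y) ∷ proj₂ y)) n) ⟩
    c * (d * diagonal (X ⊛ Y) n) ∎

mainTheorem4 : (f g : Series) → InMDadm f → InMDadm g → InMDadm (f ⋆ g)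
mainTheorem4 f g = ⋆-span generator-⋆
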